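{- Let $G$ and $H$ be finite abelian groups, written additively, of the same even order $k>2$, let $f:G\to H$ be semi-planar, and suppose $S(G,H;f)$ splits into two substructures $S_1$ and $S_2$ with $\mathcal{L}(0,0)\in S_1$. For $i=1,2$ let $P_0^i=\{b\in H : \mathcal{L}(0,b)\in S_i\}$. Then $P_0^1$ is a subgroup of $H$ of index $2$, and $P_0^2$ is its (non-trivial) coset $H\setminus P_0^1$.
   Context: A function $f:G\to H$ is semi-planar if for every non-identity $a\in G$ and every $y\in H$, the equation $f(x+a)-f(x)=y$ has either $0$ or $2$ solutions $x\in G$. The incidence structure $S(G,H;f)$ has points $(x,y)\in G\times H$ and lines $\mathcal{L}(a,b)$ for $(a,b)\in G\times H$, with $(x,y)$ incident with $\mathcal{L}(a,b)$ iff $y=f(x-a)+b$. Its incidence graph is the bipartite graph on points and lines with an edge for each incident pair. $S(G,H;f)$ splits into two substructures $S_1,S_2$ if its incidence graph has exactly two connected components; $S_1,S_2$ are the incidence structures formed by the points and lines of the two components, and $\mathcal{L}(a,b)\in S_i$ means the line lies in component $S_i$. -}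

module Defs where

open import Level using (Level; _⊔_; suc)
open import Algebra.Bundles using (AbelianGroup)
open import Data.Fin.Base using (Fin)
open import Data.Nat.Base using (ℕ)
open import Data.Product.Base using (∃-syntax; _×_; _,_; proj₁)
open import Data.Product.Relation.Binary.Pointwise.NonDependent using (_×ₛ_)
open import Data.Sum.Base using (_⊎_; inj₁; inj₂)
open import Data.Sum.Relation.Binary.Pointwise using (_⊎ₛ_)
open import Function.Bundles using (Func; Inverse; _⟶ₛ_; _⟨$⟩_)
open import Relation.Binary.Bundles using (Setoid)
open import Relation.Binary.Construct.Closure.Equivalence as EqC using (EqClosure)
import Relation.Binary.Construct.On as On
open import Relation.Binary.Core using (Rel)
open import Relation.Binary.Definitions using (_Respects_)
import Relation.Binary.PropositionalEquality as ≡
open import Relation.Nullary.Negation.Core using (¬_)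
open import Relation.Unary using (Pred; _≐_; _∈_; _∉_)
open import Relation.Unary.Relation.Binary.Equality using (≐-setoid)

private
  variable
    a c c₁ c₂ p s s₁ s₂ ℓ ℓ₁ ℓ₂ : Level

HasCardinality : Setoid a ℓ → ℕ → Set (a ⊔ ℓ)
HasCardinality A n = Inverse (≡.setoid (Fin n)) A

-- The elements of A satisfying P, still compared by the equality of A:
-- different proofs of P do not give different elements.
subsetoid : (A : Setoid a ℓ) → Pred (Setoid.Carrier A) p → Setoid (a ⊔ p) ℓ
subsetoid A P = On.setoid A (proj₁ {B = P})

module _ (G : AbelianGroup c ℓ) where
  open AbelianGroup G renaming (_∙_ to _+_; ε to 0#; _⁻¹ to -_)

  HasOrder : ℕ → Set (c ⊔ ℓ)
  HasOrder = HasCardinality setoid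

  record IsSubgroup (P : Pred Carrier p) : Set (c ⊔ ℓ ⊔ p) where
    field
      resp     : P Respects _≈_
      0∈       : 0# ∈ P
      +-closed : ∀ {x y} → x ∈ P → y ∈ P → x + y ∈ P
      -‿closed : ∀ {x} → x ∈ P → - x ∈ P

  coset : Pred Carrier p → Carrier → Pred Carrier (c ⊔ ℓ ⊔ p)
  coset P h y = ∃[ x ] x ∈ P × y ≈ h + x

  -- Each coset is represented by all of its elements; two representatives
  -- are identified when they have the same coset.
  cosetSetoid : Pred Carrier p → Setoid c (c ⊔ ℓ ⊔ p)
  cosetSetoid P = On.setoid (≐-setoid Carrier _) (coset P)

  HasIndex : Pred Carrier p → ℕ → Set (c ⊔ ℓ ⊔ p)
  HasIndex P = HasCardinality (cosetSetoid P)

  IsNontrivialCoset : Pred Carrier p → Pred Carrier s → Set (c ⊔ ℓ ⊔ p ⊔ s)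
  IsNontrivialCoset P Q = ∃[ h ] h ∉ P × Q ≐ coset P h

record IncidenceStructure (c₁ ℓ₁ c₂ ℓ₂ ℓ : Level)
       : Set (suc (c₁ ⊔ ℓ₁ ⊔ c₂ ⊔ ℓ₂ ⊔ ℓ)) where
  field
    points : Setoid c₁ ℓ₁
    lines  : Setoid c₂ ℓ₂

  Point : Set c₁
  Point = Setoid.Carrier points

  Line : Set c₂
  Line = Setoid.Carrier lines

  field
    Incident      : Point → Line → Set ℓ
    incident-resp : ∀ {p p′ l l′} →
                    Setoid._≈_ points p p′ → Setoid._≈_ lines l l′ →
                    Incident p l → Incident p′ l′

module IncidenceGraph (S : IncidenceStructure c₁ ℓ₁ c₂ ℓ₂ ℓ) where
  open IncidenceStructure S

  vertices : Setoid (c₁ ⊔ c₂) (c₁ ⊔ c₂ ⊔ ℓ₁ ⊔ ℓ₂)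
  vertices = points ⊎ₛ lines

  Vertex : Set (c₁ ⊔ c₂)
  Vertex = Setoid.Carrier vertices

  data Edge : Rel Vertex (c₁ ⊔ c₂ ⊔ ℓ) where
    edge : ∀ {p l} → Incident p l → Edge (inj₁ p) (inj₂ l)

  -- Equal vertices are joined too, since a vertex is only given up to the
  -- equality of its setoid; EqClosure allows edges to be used both ways.
  Step : Rel Vertex (c₁ ⊔ c₂ ⊔ ℓ₁ ⊔ ℓ₂ ⊔ ℓ)
  Step u v = Setoid._≈_ vertices u v ⊎ Edge u v

  Connected : Rel Vertex (c₁ ⊔ c₂ ⊔ ℓ₁ ⊔ ℓ₂ ⊔ ℓ)
  Connected = EqClosure Step

  -- The vertices, identified when they lie in the same component.
  components : Setoid (c₁ ⊔ c₂) (c₁ ⊔ c₂ ⊔ ℓ₁ ⊔ ℓ₂ ⊔ ℓ)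
  components = EqC.setoid Step

  IsComponent : Pred Vertex s → Set (c₁ ⊔ c₂ ⊔ ℓ₁ ⊔ ℓ₂ ⊔ ℓ ⊔ s)
  IsComponent C = ∃[ v ] C ≐ Connected v

-- A substructure formed by the points and lines of a component, with the
-- inherited incidence, is given by its set of points and lines.
record SplitsInto (S : IncidenceStructure c₁ ℓ₁ c₂ ℓ₂ ℓ)
                  (S₁ : Pred (IncidenceGraph.Vertex S) s₁)
                  (S₂ : Pred (IncidenceGraph.Vertex S) s₂)
                  : Set (c₁ ⊔ c₂ ⊔ ℓ₁ ⊔ ℓ₂ ⊔ ℓ ⊔ s₁ ⊔ s₂) where
  open IncidenceGraph S
  field
    twoComponents : HasCardinality components 2
    isComponent₁  : IsComponent S₁
    isComponent₂  : IsComponent S₂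
    distinct      : ¬ (S₁ ≐ S₂)

module _ (G : AbelianGroup c₁ ℓ₁) (H : AbelianGroup c₂ ℓ₂)
         (f : AbelianGroup.setoid G ⟶ₛ AbelianGroup.setoid H) where
  private
    module G = AbelianGroup G renaming (_∙_ to _+_; ε to 0#; _⁻¹ to -_)
    module H = AbelianGroup H renaming (_∙_ to _+_; ε to 0#; _⁻¹ to -_)

  solutions : G.Carrier → H.Carrier → Setoid (c₁ ⊔ ℓ₂) ℓ₁
  solutions a y =
    subsetoid G.setoid (λ x → (f ⟨$⟩ (x G.+ a)) H.+ (H.- (f ⟨$⟩ x)) H.≈ y)

  SemiPlanar : Set (c₁ ⊔ ℓ₁ ⊔ c₂ ⊔ ℓ₂)
  SemiPlanar = ∀ a → ¬ (a G.≈ G.0#) → ∀ y →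
    HasCardinality (solutions a y) 0 ⊎ HasCardinality (solutions a y) 2

  -- Both points and lines are pairs in G × H, (a , b) standing for 𝓛(a,b)
  -- in the case of lines.
  incidenceStructure :
    IncidenceStructure (c₁ ⊔ c₂) (ℓ₁ ⊔ ℓ₂) (c₁ ⊔ c₂) (ℓ₁ ⊔ ℓ₂) ℓ₂
  incidenceStructure = record
    { points        = G.setoid ×ₛ H.setoid
    ; lines         = G.setoid ×ₛ H.setoid
    ; Incident      = λ { (x , y) (a , b) → y H.≈ (f ⟨$⟩ (x G.+ (G.- a))) H.+ b }
    ; incident-resp = λ { (x≈ , y≈) (a≈ , b≈) i →
        H.trans (H.sym y≈) (H.trans i
          (H.∙-cong (Func.cong f (G.∙-cong x≈ (G.⁻¹-cong a≈))) b≈)) }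
    }

  open IncidenceGraph incidenceStructure using (Vertex)

  𝓛 : G.Carrier → H.Carrier → Vertex
  𝓛 a b = inj₂ (a , b)

  P₀ : Pred Vertex s → Pred H.Carrier s
  P₀ S b = 𝓛 G.0# b ∈ S

{-# OPTIONS --safe #-}

-- Adding h to the second coordinates of points and lines is an automorphism of
-- the incidence graph. Hence P₀¹, the set of h for which 𝓛(0,h) is connected to
-- 𝓛(0,0), is a subgroup, and b − b′ ∈ P₀¹ as soon as 𝓛(0,b) and 𝓛(0,b′) are
-- connected; with two components the index is therefore at most 2. It is not 1
-- because every vertex is connected to some 𝓛(0,b): every point is on such a
-- line, and every line has a point.
module Submission where

open import Defs
open import Algebra.Bundles using (AbelianGroup)
import Algebra.Properties.AbelianGroup as AbelianGroupProperties
open import Data.Fin.Base using (Fin; punchIn)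
open import Data.Fin.Patterns using (0F; 1F)
open import Data.Fin.Properties using (_≟_; punchInᵢ≢i)
open import Data.Nat.Base using (ℕ; _>_)
open import Data.Nat.Divisibility using (_∣_)
open import Data.Product.Base using (_×_; _,_; proj₁; proj₂; ∃-syntax)
open import Data.Sum.Base using (inj₁; inj₂)
open import Data.Sum.Relation.Binary.Pointwise using (inj₁; inj₂)
open import Function.Base using (_∘_)
open import Function.Bundles using (_⟶ₛ_; _⟨$⟩_; Inverse)
open import Function.Properties.Inverse using (Inverse⇒Injection) renaming (sym to Inverse-sym)
open import Level using (Level)
open import Relation.Binary.Bundles using (Setoid)
import Relation.Binary.Construct.Closure.Equivalence as EqC
open import Relation.Binary.Definitions using (Decidable)
open import Relation.Binary.PropositionalEquality as ≡ using (_≡_; _≢_)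
import Relation.Binary.Reasoning.Setoid as ≈-Reasoning
open import Relation.Nullary using (¬_; Dec; yes; no; contradiction)
open import Relation.Nullary.Decidable using (map′; via-injection)
open import Relation.Unary using (Pred; _∈_; _∉_; _⊆_; _≐_; ∁)
import Relation.Unary as U
open import Relation.Unary.Properties using (≐-sym; ≐-trans)

private
  variable
    c ℓ p : Level

-- Setoids with two elements.

≢-pigeonhole : ∀ {i j k : Fin 2} → i ≢ j → i ≢ k → j ≡ k
≢-pigeonhole {0F} {0F} {_}  i≢j _   = contradiction ≡.refl i≢j
≢-pigeonhole {0F} {1F} {0F} _   i≢k = contradiction ≡.refl i≢k
≢-pigeonhole {0F} {1F} {1F} _   _   = ≡.refl
≢-pigeonhole {1F} {1F} {_}  i≢j _   = contradiction ≡.refl i≢j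
≢-pigeonhole {1F} {0F} {1F} _   i≢k = contradiction ≡.refl i≢k
≢-pigeonhole {1F} {0F} {0F} _   _   = ≡.refl

module TwoElements (A : Setoid c ℓ) (card : HasCardinality A 2) where
  open Setoid A
  open Inverse card

  -- Inherited from `Fin 2` along the bijection. For components this decides connectedness without a
  -- search for paths.
  ≈-dec : Decidable _≈_
  ≈-dec = via-injection (Inverse⇒Injection (Inverse-sym card)) _≟_

  from-injective : ∀ {x y} → from x ≡ from y → x ≈ y
  from-injective {x} {y} eq =
    trans (sym (strictlyInverseˡ x)) (trans (to-cong eq) (strictlyInverseˡ y))

  ≉-pigeonhole : ∀ {x y z} → ¬ x ≈ y → ¬ x ≈ z → y ≈ z
  ≉-pigeonhole x≉y x≉z =
    from-injective (≢-pigeonhole (x≉y ∘ from-injective) (x≉z ∘ from-injective))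

  other : ∀ x → ∃[ y ] ¬ x ≈ y
  other x = to i , λ x≈to-i → punchInᵢ≢i (from x) 0F
    (≡.trans (≡.sym (strictlyInverseʳ i)) (≡.sym (from-cong x≈to-i)))
    -- `punchIn` skips `from x`, so this is the other index in `Fin 2`.
    where i = punchIn (from x) 0F

-- Cosets and subgroups of index two.

module _ (H : AbelianGroup c ℓ) where
  open AbelianGroup H renaming (_∙_ to _+_; ε to 0#; _⁻¹ to -_)
  open AbelianGroupProperties H using (//-rightDividesˡ; //-rightDividesʳ)
  open ≈-Reasoning setoid

  y+[x-y]≈x : ∀ x y → y + (x - y) ≈ x
  y+[x-y]≈x x y = trans (comm y (x - y)) (//-rightDividesˡ y x)

  module Cosets {P : Pred Carrier p} (P-isSubgroup : IsSubgroup H P) where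
    open IsSubgroup P-isSubgroup

    difference⇒coset-⊆ : ∀ {x y} → x - y ∈ P → coset H P x ⊆ coset H P y
    difference⇒coset-⊆ {x} {y} x-y∈P {w} (z , z∈P , w≈x+z) =
      (x - y) + z , +-closed x-y∈P z∈P , (begin
        w                  ≈⟨ w≈x+z ⟩
        x + z              ≈⟨ ∙-congʳ (y+[x-y]≈x x y) ⟨
        (y + (x - y)) + z  ≈⟨ assoc y (x - y) z ⟩
        y + ((x - y) + z)  ∎)

    -- As `0#` is in `P`, `x` lies in its own coset, hence is `y + z` with `y` and `z` in `P`.
    coset-⊆⇒∈ : ∀ {x y} → coset H P x ⊆ coset H P y → y ∈ P → x ∈ P
    coset-⊆⇒∈ {x} x⊆y y∈P with x⊆y (0# , 0∈ , sym (identityʳ x))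
    ... | z , z∈P , x≈y+z = resp (sym x≈y+z) (+-closed y∈P z∈P)

    ∈⇒coset-≐ : ∀ {x y} → x ∈ P → y ∈ P → coset H P x ≐ coset H P y
    ∈⇒coset-≐ x∈P y∈P =
      difference⇒coset-⊆ (+-closed x∈P (-‿closed y∈P)) ,
      difference⇒coset-⊆ (+-closed y∈P (-‿closed x∈P))

    -- `h∉P` yields at least two cosets and `∉-difference` at most two; `P?` makes the index of a
    -- coset computable.
    module IndexTwo
      (P? : U.Decidable P)
      {h : Carrier} (h∉P : h ∉ P)
      (∉-difference : ∀ {x y} → x ∉ P → y ∉ P → x - y ∈ P)
      where

      ∁-coset : ∁ P ≐ coset H P h
      ∁-coset =
        (λ {y} y∉P → y - h , ∉-difference y∉P h∉P , sym (y+[x-y]≈x y h)) ,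
        -- If `y ≈ h + x` were in `P`, so would be `h`, being `y - x`.
        (λ {y} (x , x∈P , y≈h+x) y∈P → h∉P (resp
          (trans (∙-congʳ y≈h+x) (//-rightDividesʳ x h))
          (+-closed y∈P (-‿closed x∈P))))

      ∉⇒coset-≐ : ∀ {x y} → x ∉ P → y ∉ P → coset H P x ≐ coset H P y
      ∉⇒coset-≐ x∉P y∉P =
        difference⇒coset-⊆ (∉-difference x∉P y∉P) ,
        difference⇒coset-⊆ (∉-difference y∉P x∉P)

      representative : Fin 2 → Carrier
      representative 0F = 0#
      representative 1F = h

      -- Defined on decisions, not elements, so that the lemmas below can split on arbitrary
      -- decisions.
      decIndex : ∀ {y} → Dec (y ∈ P) → Fin 2
      decIndex (yes _) = 0F
      decIndex (no  _) = 1F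

      decIndex-cong : ∀ {x y} → coset H P x ≐ coset H P y →
                      (d : Dec (x ∈ P)) (e : Dec (y ∈ P)) → decIndex d ≡ decIndex e
      decIndex-cong _         (yes _)   (yes _)   = ≡.refl
      decIndex-cong (_ , y⊆x) (yes x∈P) (no y∉P)  = contradiction (coset-⊆⇒∈ y⊆x x∈P) y∉P
      decIndex-cong (x⊆y , _) (no x∉P)  (yes y∈P) = contradiction (coset-⊆⇒∈ x⊆y y∈P) x∉P
      decIndex-cong _         (no _)    (no _)    = ≡.refl

      representative-decIndex : ∀ {y} (d : Dec (y ∈ P)) →
                                coset H P (representative (decIndex d)) ≐ coset H P y
      representative-decIndex (yes y∈P) = ∈⇒coset-≐ 0∈ y∈P
      representative-decIndex (no  y∉P) = ∉⇒coset-≐ h∉P y∉P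

      decIndex-representative : ∀ i (d : Dec (representative i ∈ P)) → decIndex d ≡ i
      decIndex-representative 0F (yes _)   = ≡.refl
      decIndex-representative 0F (no 0∉P)  = contradiction 0∈ 0∉P
      decIndex-representative 1F (yes h∈P) = contradiction h∈P h∉P
      decIndex-representative 1F (no _)    = ≡.refl

      hasIndex-2 : HasIndex H P 2
      hasIndex-2 = record
        { to        = representative
        ; from      = λ y → decIndex (P? y)
        ; to-cong   = λ { ≡.refl → ≈.refl }
        ; from-cong = λ {x} {y} x≐y → decIndex-cong x≐y (P? x) (P? y)
        ; inverse   =
            (λ { {x} {y} ≡.refl → representative-decIndex (P? x) }) ,
            (λ {i} {y} y≐i → ≡.trans
              (decIndex-cong y≐i (P? y) (P? (representative i)))
              (decIndex-representative i (P? (representative i))))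
        }
        where module ≈ = Setoid (cosetSetoid H P)

-- Components and translations of the incidence graph.

module _ {c₁ ℓ₁ c₂ ℓ₂ ℓ : Level} (S : IncidenceStructure c₁ ℓ₁ c₂ ℓ₂ ℓ) where
  open IncidenceGraph S

  -- Connectedness is an equivalence, so any member of a component can replace its given root.
  component-≐ : ∀ {s} {C : Pred Vertex s} {v} → IsComponent C → v ∈ C → C ≐ Connected v
  component-≐ (u , C⊆ , ⊇C) v∈C =
    (λ w∈C → trans (sym (C⊆ v∈C)) (C⊆ w∈C)) ,
    (λ v~w → ⊇C (trans (C⊆ v∈C) v~w))
    where open Setoid components using (trans; sym)

module _ {c₁ ℓ₁ c₂ ℓ₂ : Level}
         (G : AbelianGroup c₁ ℓ₁) (H : AbelianGroup c₂ ℓ₂)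
         (f : AbelianGroup.setoid G ⟶ₛ AbelianGroup.setoid H) where
  private
    module G = AbelianGroup G renaming (_∙_ to _+_; ε to 0#; _⁻¹ to -_)
    module H = AbelianGroup H renaming (_∙_ to _+_; ε to 0#; _⁻¹ to -_)

  open IncidenceGraph (incidenceStructure G H f)
  open Setoid components using () renaming (refl to ~-refl; sym to ~-sym; trans to ~-trans)

  shift : H.Carrier → Vertex → Vertex
  shift h (inj₁ (x , y)) = inj₁ (x , y H.+ h)
  shift h (inj₂ (a , b)) = inj₂ (a , b H.+ h)

  -- Incidence equates `y` with a sum ending in `b`, so adding `h` to both preserves it up to
  -- associativity.
  shift-step : ∀ h {u v} → Step u v → Step (shift h u) (shift h v)
  shift-step h (inj₁ (inj₁ (x≈ , y≈))) = inj₁ (inj₁ (x≈ , H.∙-congʳ y≈))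
  shift-step h (inj₁ (inj₂ (a≈ , b≈))) = inj₁ (inj₂ (a≈ , H.∙-congʳ b≈))
  shift-step h (inj₂ (edge i))         =
    inj₂ (edge (H.trans (H.∙-congʳ i) (H.assoc _ _ h)))

  shift-connected : ∀ h {u v} → Connected u v → Connected (shift h u) (shift h v)
  shift-connected h = EqC.gmap (shift h) (shift-step h)

  𝓛₀ : H.Carrier → Vertex
  𝓛₀ = 𝓛 G H f G.0#

  𝓛₀-cong : ∀ {b b′} → b H.≈ b′ → Connected (𝓛₀ b) (𝓛₀ b′)
  𝓛₀-cong b≈b′ = EqC.return (inj₁ (inj₂ (G.refl , b≈b′)))

  -- Free endpoints `d` and `d′` let uses name shifted lines in simplified form, such as `H.0#` for
  -- `y H.- y`.
  shift-𝓛₀ : ∀ {b b′ d d′} h → b H.+ h H.≈ d → b′ H.+ h H.≈ d′ →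
             Connected (𝓛₀ b) (𝓛₀ b′) → Connected (𝓛₀ d) (𝓛₀ d′)
  shift-𝓛₀ h b+h≈d b′+h≈d′ b~b′ =
    ~-trans (~-sym (𝓛₀-cong b+h≈d))
      (~-trans (shift-connected h b~b′) (𝓛₀-cong b′+h≈d′))

  point~𝓛₀ : ∀ x y → ∃[ b ] Connected (inj₁ (x , y)) (𝓛₀ b)
  point~𝓛₀ x y = b , EqC.return (inj₂ (edge (H.sym (y+[x-y]≈x H y _))))
    -- The incidence equation with `a = G.0#`, solved for `b`.
    where b = y H.- (f ⟨$⟩ (x G.- G.0#))

  vertex~𝓛₀ : ∀ v → ∃[ b ] Connected v (𝓛₀ b)
  vertex~𝓛₀ (inj₁ (x , y)) = point~𝓛₀ x y
  -- Pass to the point of the line over `G.0#`.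
  vertex~𝓛₀ (inj₂ (a , b)) with point~𝓛₀ G.0# ((f ⟨$⟩ (G.0# G.- a)) H.+ b)
  ... | d , p~d = d , ~-trans (~-sym (EqC.return (inj₂ (edge H.refl)))) p~d

  -- Consequences of having two components.

  module _ {s₁ s₂ : Level} {S₁ : Pred Vertex s₁} {S₂ : Pred Vertex s₂}
           (splits : SplitsInto (incidenceStructure G H f) S₁ S₂)
           (0∈S₁ : 𝓛₀ H.0# ∈ S₁) where
    open SplitsInto splits
    open TwoElements components twoComponents

    S₁≐ : S₁ ≐ Connected (𝓛₀ H.0#)
    S₁≐ = component-≐ (incidenceStructure G H f) isComponent₁ 0∈S₁

    -- A common vertex would make both sets its component. Conversely, a vertex outside `S₁` and the
    -- root of `S₂` both avoid the component of `𝓛₀ H.0#`, so they are connected.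
    S₂≐∁S₁ : S₂ ≐ ∁ S₁
    S₂≐∁S₁ = disjoint , λ {v} v∉S₁ →
      proj₂ (proj₂ isComponent₂) (≉-pigeonhole (root∉S₁ ∘ proj₂ S₁≐) (v∉S₁ ∘ proj₂ S₁≐))
      where
      disjoint : S₂ ⊆ ∁ S₁
      disjoint v∈S₂ v∈S₁ = distinct (≐-trans
        (component-≐ (incidenceStructure G H f) isComponent₁ v∈S₁)
        (≐-sym (component-≐ (incidenceStructure G H f) isComponent₂ v∈S₂)))

      root∉S₁ : proj₁ isComponent₂ ∉ S₁
      root∉S₁ = disjoint (proj₂ (proj₂ isComponent₂) ~-refl)

    P₀¹ : Pred H.Carrier s₁
    P₀¹ = P₀ G H f S₁

    P₀¹-isSubgroup : IsSubgroup H P₀¹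
    P₀¹-isSubgroup = record
      { resp     = λ b≈b′ b∈ → proj₂ S₁≐ (~-trans (proj₁ S₁≐ b∈) (𝓛₀-cong b≈b′))
      ; 0∈       = 0∈S₁
      -- Shifted by `y`, the path from `𝓛₀ H.0#` to `𝓛₀ x` starts at `𝓛₀ y`.
      ; +-closed = λ {x} {y} x∈ y∈ → proj₂ S₁≐ (~-trans (proj₁ S₁≐ y∈)
          (shift-𝓛₀ y (H.identityˡ y) H.refl (proj₁ S₁≐ x∈)))
      -- Shifted by `H.- x`, the same path ends at `𝓛₀ H.0#`.
      ; -‿closed = λ {x} x∈ → proj₂ S₁≐ (~-sym
          (shift-𝓛₀ (H.- x) (H.identityˡ (H.- x)) (H.inverseʳ x) (proj₁ S₁≐ x∈)))
      }

    P₀¹? : U.Decidable P₀¹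
    P₀¹? b = map′ (proj₂ S₁≐) (proj₁ S₁≐) (≈-dec (𝓛₀ H.0#) (𝓛₀ b))

    -- By pigeonhole `𝓛₀ y` and `𝓛₀ x` share the other component; shifting by `H.- y` moves the
    -- first to `𝓛₀ H.0#`.
    P₀¹-∉-difference : ∀ {x y} → x ∉ P₀¹ → y ∉ P₀¹ → x H.- y ∈ P₀¹
    P₀¹-∉-difference {x} {y} x∉ y∉ = proj₂ S₁≐
      (shift-𝓛₀ (H.- y) (H.inverseʳ y) H.refl
        (≉-pigeonhole (y∉ ∘ proj₂ S₁≐) (x∉ ∘ proj₂ S₁≐)))

    -- A vertex of the other component can be any point or line; `vertex~𝓛₀` trades it for some
    -- `𝓛₀ h`.
    P₀¹-proper : ∃[ h ] h ∉ P₀¹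
    P₀¹-proper with other (𝓛₀ H.0#)
    ... | v , 0≁v with vertex~𝓛₀ v
    ... | h , v~h = h , λ h∈ → 0≁v (~-trans (proj₁ S₁≐ h∈) (~-sym v~h))

theorem2 : ∀ {c₁ ℓ₁ c₂ ℓ₂ s₁ s₂ : Level}
    (G : AbelianGroup c₁ ℓ₁) (H : AbelianGroup c₂ ℓ₂)
    (k : ℕ) → 2 ∣ k → k > 2 → HasOrder G k → HasOrder H k →
    (f : AbelianGroup.setoid G ⟶ₛ AbelianGroup.setoid H) →
    SemiPlanar G H f →
    (S₁ : Pred (IncidenceGraph.Vertex (incidenceStructure G H f)) s₁)
    (S₂ : Pred (IncidenceGraph.Vertex (incidenceStructure G H f)) s₂) →
    SplitsInto (incidenceStructure G H f) S₁ S₂ →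
    𝓛 G H f (AbelianGroup.ε G) (AbelianGroup.ε H) ∈ S₁ →
    (IsSubgroup H (P₀ G H f S₁) × HasIndex H (P₀ G H f S₁) 2)
    × (P₀ G H f S₂ ≐ ∁ (P₀ G H f S₁)
    × IsNontrivialCoset H (P₀ G H f S₁) (P₀ G H f S₂))
theorem2 G H _ _ _ _ _ f _ S₁ S₂ splits 0∈S₁ =
  (isSubgroup , hasIndex-2) , P₀²≐∁P₀¹ , h , h∉P₀¹ ,
    -- The complement of the subgroup links `P₀ G H f S₂` to the coset of `h`.
    ((λ b∈ → proj₁ ∁-coset (proj₁ P₀²≐∁P₀¹ b∈)) ,
     (λ b∈ → proj₂ P₀²≐∁P₀¹ (proj₂ ∁-coset b∈)))
  where
  isSubgroup = P₀¹-isSubgroup G H f splits 0∈S₁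
  h          = proj₁ (P₀¹-proper G H f splits 0∈S₁)
  h∉P₀¹      = proj₂ (P₀¹-proper G H f splits 0∈S₁)

  open Cosets H isSubgroup
  open IndexTwo (P₀¹? G H f splits 0∈S₁) h∉P₀¹ (P₀¹-∉-difference G H f splits 0∈S₁)

  P₀²≐∁P₀¹ : P₀ G H f S₂ ≐ ∁ (P₀ G H f S₁)
  P₀²≐∁P₀¹ = (λ b∈ → proj₁ (S₂≐∁S₁ G H f splits 0∈S₁) b∈) ,
             (λ b∉ → proj₂ (S₂≐∁S₁ G H f splits 0∈S₁) b∉)
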